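{- Let $G$ be an esp-digraph. Then $\chi_o(G)\le 7$.
   Context: An oriented graph is a digraph without loops and without pairs of opposite arcs. For a digraph $G=(V,E)$ (parallel arcs allowed; the definitions apply verbatim), an oriented $r$-vertex-coloring is a map $c:V\to\{1,\dots,r\}$ such that (i) $c(u)\ne c(v)$ for every arc $(u,v)\in E$, and (ii) $c(u)\ne c(y)$ for every two arcs $(u,v),(x,y)\in E$ with $c(v)=c(x)$. Equivalently, $c$ is a homomorphism to an oriented graph on $r$ vertices. The oriented chromatic number $\chi_o(G)$ is the smallest $r$ for which such a coloring exists. Edge series-parallel (multi)digraphs (esp-digraphs) are defined recursively, each with a distinguished source and sink: (i) a digraph with two distinct vertices $u,v$ and the single arc $(u,v)$ is an esp-digraph with source $u$ and sink $v$; (ii) if $G_1,G_2$ are vertex-disjoint esp-digraphs, then the parallel composition $G_1\cup G_2$ (identify the source of $G_1$ with the source of $G_2$ and the sink of $G_1$ with the sink of $G_2$; arcs are united, possibly creating parallel arcs) is an esp-digraph with these identified source and sink, and the series composition $G_1\times G_2$ (identify the sink of $G_1$ with the source of $G_2$) is an esp-digraph with source the source of $G_1$ and sink the sink of $G_2$. -}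

module Defs where

open import Data.Fin using (Fin)
open import Data.Nat using (ℕ; _≤_)
open import Data.Product using (∃; _×_)
open import Data.Sum using (_⊎_; inj₁; inj₂)
open import Function.Bundles using (_↔_; _⇔_; Inverse)
open import Function.Definitions using (Injective)
open import Relation.Binary.PropositionalEquality using (_≡_; _≢_)

-- Arcs are named rather than being pairs of vertices, so that parallel arcs
-- are allowed.
record Digraph : Set where
  field
    #vertices : ℕ
    #arcs     : ℕ

  Vertex : Set
  Vertex = Fin #vertices

  Arc : Set
  Arc = Fin #arcs

  field
    tail : Arc → Vertex
    head : Arc → Vertex

open Digraph public

record IsOrientedColoring (G : Digraph) (r : ℕ) (c : Vertex G → Fin r) : Set where
  field
    proper   : ∀ e → c (tail G e) ≢ c (head G e)
    oriented : ∀ e f → c (head G e) ≡ c (tail G f) → c (tail G e) ≢ c (head G f)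

OrientedColorable : Digraph → ℕ → Set
OrientedColorable G r = ∃ λ (c : Vertex G → Fin r) → IsOrientedColoring G r c

-- A relation, because a digraph with a loop or a pair of opposite arcs
-- has no oriented coloring at all.
record IsOrientedChromaticNumber (G : Digraph) (r : ℕ) : Set where
  field
    colorable : OrientedColorable G r
    smallest  : ∀ k → OrientedColorable G k → r ≤ k

-- Gluing G₁ G₂ _~_ G exhibits G as the digraph obtained from disjoint copies
-- of G₁ and G₂ by identifying x in G₁ with y in G₂ exactly when x ~ y, and
-- making no other identification; the arcs of G are the disjoint union of the
-- arcs of G₁ and G₂. This determines G up to isomorphism.
record Gluing (G₁ G₂ : Digraph) (_~_ : Vertex G₁ → Vertex G₂ → Set) (G : Digraph) : Set where
  field
    ι₁ : Vertex G₁ → Vertex G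
    ι₂ : Vertex G₂ → Vertex G
    ι₁-injective : Injective _≡_ _≡_ ι₁
    ι₂-injective : Injective _≡_ _≡_ ι₂
    identified   : ∀ x y → ι₁ x ≡ ι₂ y ⇔ x ~ y
    covered      : ∀ v → (∃ λ x → ι₁ x ≡ v) ⊎ (∃ λ y → ι₂ y ≡ v)

    arcs : (Arc G₁ ⊎ Arc G₂) ↔ Arc G

  open Inverse arcs using (to)

  field
    tail₁ : ∀ e → tail G (to (inj₁ e)) ≡ ι₁ (tail G₁ e)
    head₁ : ∀ e → head G (to (inj₁ e)) ≡ ι₁ (head G₁ e)
    tail₂ : ∀ e → tail G (to (inj₂ e)) ≡ ι₂ (tail G₂ e)
    head₂ : ∀ e → head G (to (inj₂ e)) ≡ ι₂ (head G₂ e)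

record SingleArc (G : Digraph) (u v : Vertex G) : Set where
  field
    distinct    : u ≢ v
    vertices    : ∀ w → w ≡ u ⊎ w ≡ v
    arc         : Arc G
    arc-unique  : ∀ e → e ≡ arc
    tail-arc    : tail G arc ≡ u
    head-arc    : head G arc ≡ v

ParallelComposition : (G₁ : Digraph) (s₁ t₁ : Vertex G₁) (G₂ : Digraph) (s₂ t₂ : Vertex G₂) → Digraph → Set
ParallelComposition G₁ s₁ t₁ G₂ s₂ t₂ =
  Gluing G₁ G₂ (λ x y → (x ≡ s₁ × y ≡ s₂) ⊎ (x ≡ t₁ × y ≡ t₂))

SeriesComposition : (G₁ : Digraph) (t₁ : Vertex G₁) (G₂ : Digraph) (s₂ : Vertex G₂) → Digraph → Set
SeriesComposition G₁ t₁ G₂ s₂ = Gluing G₁ G₂ (λ x y → x ≡ t₁ × y ≡ s₂)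

-- IsEsp G s t: G is an edge series-parallel multidigraph with source s and sink t.
data IsEsp : (G : Digraph) → Vertex G → Vertex G → Set where
  single : ∀ {G u v} → SingleArc G u v → IsEsp G u v

  parallel : ∀ {G₁ s₁ t₁ G₂ s₂ t₂ G} →
             IsEsp G₁ s₁ t₁ → IsEsp G₂ s₂ t₂ →
             (g : ParallelComposition G₁ s₁ t₁ G₂ s₂ t₂ G) →
             IsEsp G (Gluing.ι₁ g s₁) (Gluing.ι₁ g t₁)

  series : ∀ {G₁ s₁ t₁ G₂ s₂ t₂ G} →
           IsEsp G₁ s₁ t₁ → IsEsp G₂ s₂ t₂ →
           (g : SeriesComposition G₁ t₁ G₂ s₂ G) →
           IsEsp G (Gluing.ι₁ g s₁) (Gluing.ι₂ g t₂)

{-# OPTIONS --safe #-}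
-- Every arc of the Paley tournament on ℤ/7 (a → b iff b − a is a nonzero
-- square) is bypassed by a directed path of length two. So, by induction on the
-- decomposition, each of its arcs a → b extends to a homomorphism from the
-- esp-digraph sending the source to a and the sink to b: a parallel composition
-- reuses a → b on both parts, a series composition uses a → m and m → b.
module Submission where

open import Data.Nat using (_≤_)
open import Data.Product using (∃; _×_)
open import Defs

open import Data.Fin using (Fin; zero; suc; toℕ; finToFun; funToFin)
open import Data.Fin.Properties using (_≟_; all?; any?; finToFun-funToFin)
open import Data.Nat using (ℕ; zero; suc; _+_; _^_; NonZero; z≤n; s≤s)
import Data.Nat.Properties as ℕ
open import Data.Nat.DivMod using (_%_)
open import Data.Product using (_,_; proj₁)
open import Data.Sum using (_⊎_; inj₁; inj₂; [_,_]′)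
open import Data.Vec.Functional using (updateAt)
open import Data.Vec.Functional.Properties using (updateAt-updates; updateAt-minimal)
open import Function using (_∘_; const; Equivalence; Inverse)
open import Level using (Level; 0ℓ; _⊔_)
open import Relation.Binary using (Rel; Asymmetric; Dense; _Respects_)
import Relation.Binary as Binary
open import Relation.Binary.Consequences using (asym⇒irr)
open import Relation.Binary.PropositionalEquality
open import Relation.Nullary using (Dec; yes; no; contradiction)
open import Relation.Nullary.Decidable using (map′; from-yes; ¬?; _×-dec_; _→-dec_)
open import Relation.Unary using (Pred; Decidable)

private
  variable
    a p ℓ : Level
    m n r : ℕ
    A : Set a
    G G₁ G₂ : Digraph

anyFunction? : {P : Pred (Fin m → Fin n) p} → P Respects _≗_ → Decidable P → Dec (∃ P)
anyFunction? resp P? =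
  map′ (λ (i , Pi) → finToFun i , Pi)
       (λ (f , Pf) → funToFin f , resp (sym ∘ finToFun-funToFin f) Pf)
       (any? (P? ∘ finToFun))

leastWitness : {P : Pred ℕ p} → Decidable P → ∀ n → P n →
               ∃ λ m → P m × (∀ k → P k → m ≤ k)
leastWitness P? zero P0 = zero , P0 , λ _ _ → z≤n
leastWitness {P = P} P? (suc n) Pn with P? zero
... | yes P0 = zero , P0 , λ _ _ → z≤n
... | no ¬P0 with m , Pm , m-least ← leastWitness (P? ∘ suc) n Pn = suc m , Pm , suc-least
  where
  suc-least : ∀ k → P k → suc m ≤ k
  suc-least zero    P0 = contradiction P0 ¬P0
  suc-least (suc k) Pk = s≤s (m-least k Pk)

isOrientedColoring? : ∀ G → Decidable (IsOrientedColoring G r)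
isOrientedColoring? G c =
  map′ (λ (p , o) → record { proper = p ; oriented = o }) (λ col → proper col , oriented col)
    ((all? λ e → ¬? (c (tail G e) ≟ c (head G e))) ×-dec
     (all? λ e → all? λ f → (c (head G e) ≟ c (tail G f)) →-dec ¬? (c (tail G e) ≟ c (head G f))))
  where open IsOrientedColoring

isOrientedColoring-resp-≗ : IsOrientedColoring G r Respects _≗_
isOrientedColoring-resp-≗ c≗d col = record
  { proper   = λ e → subst₂ _≢_ (c≗d _) (c≗d _) (proper e)
  ; oriented = λ e f h≡t → subst₂ _≢_ (c≗d _) (c≗d _)
                             (oriented e f (trans (c≗d _) (trans h≡t (sym (c≗d _)))))
  }
  where open IsOrientedColoring col

orientedColorable? : ∀ G → Decidable (OrientedColorable G)
orientedColorable? G r = anyFunction? isOrientedColoring-resp-≗ (isOrientedColoring? G)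

colorable⇒chromaticNumber≤ : OrientedColorable G r →
                             ∃ λ χ → IsOrientedChromaticNumber G χ × χ ≤ r
colorable⇒chromaticNumber≤ {G} {r} colorable
  with χ , χ-colorable , χ-least ← leastWitness (orientedColorable? G) r colorable
  = χ , record { colorable = χ-colorable ; smallest = χ-least } , χ-least r colorable

IsHomomorphism : (G : Digraph) → Rel A ℓ → (Vertex G → A) → Set ℓ
IsHomomorphism G _⟶_ h = ∀ e → h (tail G e) ⟶ h (head G e)

homomorphism⇒coloring : (_⟶_ : Rel (Fin r) ℓ) → Asymmetric _⟶_ →
                        ∀ {c} → IsHomomorphism G _⟶_ c → IsOrientedColoring G r c
homomorphism⇒coloring _⟶_ asym hom = record
  { proper   = λ e t≡h → asym⇒irr (resp₂ _⟶_) sym asym t≡h (hom e)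
  ; oriented = λ e f h≡t t≡h → asym (hom e) (subst₂ _⟶_ (sym h≡t) (sym t≡h) (hom f))
  }

module _ {_~_ : Vertex G₁ → Vertex G₂ → Set} (g : Gluing G₁ G₂ _~_ G) where
  open Gluing g
  open Inverse arcs using (to; from; strictlyInverseˡ)

  gluing-arc-elim : (P : Pred (Arc G) p) →
                    (∀ e → P (to (inj₁ e))) → (∀ e → P (to (inj₂ e))) → ∀ e → P e
  gluing-arc-elim P P₁ P₂ e = subst P (strictlyInverseˡ e) (P-to (from e))
    where
    P-to : ∀ e → P (to e)
    P-to (inj₁ e₁) = P₁ e₁
    P-to (inj₂ e₂) = P₂ e₂

  module _ {h₁ : Vertex G₁ → A} {h₂ : Vertex G₂ → A}
           (agree : ∀ {x y} → x ~ y → h₁ x ≡ h₂ y) where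

    glue : Vertex G → A
    glue v = [ h₁ ∘ proj₁ , h₂ ∘ proj₁ ]′ (covered v)

    glue-ι₁ : ∀ x → glue (ι₁ x) ≡ h₁ x
    glue-ι₁ x with covered (ι₁ x)
    ... | inj₁ (_ , eq) = cong h₁ (ι₁-injective eq)
    ... | inj₂ (y , eq) = sym (agree (Equivalence.to (identified x y) (sym eq)))

    glue-ι₂ : ∀ y → glue (ι₂ y) ≡ h₂ y
    glue-ι₂ y with covered (ι₂ y)
    ... | inj₁ (x , eq) = agree (Equivalence.to (identified x y) eq)
    ... | inj₂ (_ , eq) = cong h₂ (ι₂-injective eq)

    glue-homomorphism : (_⟶_ : Rel A ℓ) → IsHomomorphism G₁ _⟶_ h₁ → IsHomomorphism G₂ _⟶_ h₂ →
                        IsHomomorphism G _⟶_ glue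
    glue-homomorphism _⟶_ hom₁ hom₂ = gluing-arc-elim _ on-arcs₁ on-arcs₂
      where
      on-arcs₁ : ∀ e → glue (tail G (to (inj₁ e))) ⟶ glue (head G (to (inj₁ e)))
      on-arcs₁ e rewrite tail₁ e | head₁ e | glue-ι₁ (tail G₁ e) | glue-ι₁ (head G₁ e) = hom₁ e

      on-arcs₂ : ∀ e → glue (tail G (to (inj₂ e))) ⟶ glue (head G (to (inj₂ e)))
      on-arcs₂ e rewrite tail₂ e | head₂ e | glue-ι₂ (tail G₂ e) | glue-ι₂ (head G₂ e) = hom₂ e

module _ {A : Set a} (_⟶_ : Rel A ℓ) where

  TerminalHomomorphism : (G : Digraph) (s t : Vertex G) (x y : A) → Set (a ⊔ ℓ)
  TerminalHomomorphism G s t x y = ∃ λ h → IsHomomorphism G _⟶_ h × h s ≡ x × h t ≡ y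

  single-homomorphism : ∀ {s t x y} → SingleArc G s t → x ⟶ y → TerminalHomomorphism G s t x y
  single-homomorphism {G} {s} {t} {x} {y} single-arc x⟶y = h , hom , h-source , h-sink
    where
    open SingleArc single-arc

    h : Vertex G → A
    h = updateAt (const y) s (const x)

    h-source : h s ≡ x
    h-source = updateAt-updates s (const y)

    h-sink : h t ≡ y
    h-sink = updateAt-minimal t s (const y) (distinct ∘ sym)

    hom : IsHomomorphism G _⟶_ h
    hom e rewrite arc-unique e | tail-arc | head-arc | h-source | h-sink = x⟶y

  parallel-homomorphism : ∀ {s₁ t₁ s₂ t₂ x y} (g : ParallelComposition G₁ s₁ t₁ G₂ s₂ t₂ G) →
                          TerminalHomomorphism G₁ s₁ t₁ x y →
                          TerminalHomomorphism G₂ s₂ t₂ x y →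
                          TerminalHomomorphism G (Gluing.ι₁ g s₁) (Gluing.ι₁ g t₁) x y
  parallel-homomorphism {s₁ = s₁} {t₁} {s₂} {t₂} g
                        (h₁ , hom₁ , refl , refl) (h₂ , hom₂ , s₂↦x , t₂↦y) =
    glue g agree , glue-homomorphism g agree _⟶_ hom₁ hom₂ ,
    glue-ι₁ g agree s₁ , glue-ι₁ g agree t₁
    where
    agree : ∀ {u v} → (u ≡ s₁ × v ≡ s₂) ⊎ (u ≡ t₁ × v ≡ t₂) → h₁ u ≡ h₂ v
    agree (inj₁ (refl , refl)) = sym s₂↦x
    agree (inj₂ (refl , refl)) = sym t₂↦y

  series-homomorphism : ∀ {s₁ t₁ s₂ t₂ x y z} (g : SeriesComposition G₁ t₁ G₂ s₂ G) →
                        TerminalHomomorphism G₁ s₁ t₁ x y →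
                        TerminalHomomorphism G₂ s₂ t₂ y z →
                        TerminalHomomorphism G (Gluing.ι₁ g s₁) (Gluing.ι₂ g t₂) x z
  series-homomorphism {s₁ = s₁} {t₁} {s₂} {t₂} g
                      (h₁ , hom₁ , refl , refl) (h₂ , hom₂ , s₂↦y , refl) =
    glue g agree , glue-homomorphism g agree _⟶_ hom₁ hom₂ ,
    glue-ι₁ g agree s₁ , glue-ι₂ g agree t₂
    where
    agree : ∀ {u v} → u ≡ t₁ × v ≡ s₂ → h₁ u ≡ h₂ v
    agree (refl , refl) = sym s₂↦y

  esp-homomorphism : Dense _⟶_ → ∀ {s t x y} → IsEsp G s t → x ⟶ y →
                     TerminalHomomorphism G s t x y
  esp-homomorphism dense (single single-arc) x⟶y = single-homomorphism single-arc x⟶y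
  esp-homomorphism dense (parallel esp₁ esp₂ g) x⟶y =
    parallel-homomorphism g (esp-homomorphism dense esp₁ x⟶y) (esp-homomorphism dense esp₂ x⟶y)
  esp-homomorphism dense (series esp₁ esp₂ g) x⟶y with _ , x⟶z , z⟶y ← dense x⟶y =
    series-homomorphism g (esp-homomorphism dense esp₁ x⟶z) (esp-homomorphism dense esp₂ z⟶y)

esp-colorable : (_⟶_ : Rel (Fin r) ℓ) → Asymmetric _⟶_ → Dense _⟶_ →
                ∀ {s t x y} → x ⟶ y → IsEsp G s t → OrientedColorable G r
esp-colorable _⟶_ asym dense x⟶y esp with c , c-hom , _ ← esp-homomorphism _⟶_ dense esp x⟶y
  = c , homomorphism⇒coloring _⟶_ asym c-hom

-- For a prime n, this is a tournament exactly when n ≡ 3 (mod 4).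
Paley : ∀ n → .{{NonZero n}} → Rel (Fin n) 0ℓ
Paley n x y = x ≢ y × ∃ λ (z : Fin n) → toℕ y ≡ (toℕ x + toℕ z ^ 2) % n

paley? : ∀ n → .{{_ : NonZero n}} → Binary.Decidable (Paley n)
paley? n x y = ¬? (x ≟ y) ×-dec any? λ z → toℕ y ℕ.≟ (toℕ x + toℕ z ^ 2) % n

paley₇-asym : Asymmetric (Paley 7)
paley₇-asym {x} {y} =
  from-yes (all? λ x → all? λ y → paley? 7 x y →-dec ¬? (paley? 7 y x)) x y

paley₇-dense : Dense (Paley 7)
paley₇-dense {x} {y} =
  from-yes (all? λ x → all? λ y → paley? 7 x y →-dec any? λ z → paley? 7 x z ×-dec paley? 7 z y) x y

paley₇-0⟶1 : Paley 7 zero (suc zero)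
paley₇-0⟶1 = (λ ()) , suc zero , refl

theorem3 : (G : Digraph) (s t : Vertex G) → IsEsp G s t →
    ∃ λ χ → IsOrientedChromaticNumber G χ × χ ≤ 7
theorem3 G s t esp =
  colorable⇒chromaticNumber≤ (esp-colorable (Paley 7) paley₇-asym paley₇-dense paley₇-0⟶1 esp)
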